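{- For every integer $n \ge 3$, $$\frac{n!!}{(n-1)!!} = \frac{1}{\left(\frac{(n-1)!!}{(n-2)!!}\right)} + \frac{(n-2)!!}{(n-3)!!}.$$
   Context: Here $m!!$ denotes the double factorial: $(2m)!! = (2m)(2m-2)\cdots 2$, $(2m+1)!! = (2m+1)(2m-1)\cdots 1$, and $0!! = 1$. -}

module Defs where

open import Data.Nat as ℕ using (ℕ; zero; suc; _*_)
open import Data.Nat.Properties using (m*n≢0)
open import Data.Integer using (+_)
open import Data.Rational as ℚ using (ℚ; _/_)
open import Data.Rational.Properties using (normalize-pos; pos⇒nonZero)

infix 9 _!! _!!/_!!

_!! : ℕ → ℕ
zero !! = 1
suc zero !! = 1
suc (suc n) !! = suc (suc n) * n !!

_!!≢0 : ∀ n → ℕ.NonZero (n !!)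
zero !!≢0 = _
suc zero !!≢0 = _
suc (suc n) !!≢0 = m*n≢0 (suc (suc n)) (n !!) {{_}} {{n !!≢0}}

-- A single mixfix operator, so that the nonzero denominator need not be
-- supplied at each use.
_!!/_!! : ℕ → ℕ → ℚ
m !!/ n !! = (+ (m !!) / (n !!)) {{n !!≢0}}

!!/!!-nonZero : ∀ m n → ℚ.NonZero (m !!/ n !!)
!!/!!-nonZero m n =
  pos⇒nonZero (m !!/ n !!) {{normalize-pos (m !!) (n !!) {{n !!≢0}} {{m !!≢0}}}}

{-# OPTIONS --safe #-}
-- With s = n − 1, a = (n − 2)!! and b = (n − 3)!! one has n!! = (s + 1) a and
-- (n − 1)!! = s b, so the claim is (s + 1) a / (s b) = a / (s b) + a / b.

module Submission where

open import Defs
open import Data.Integer as ℤ using (ℤ; +_)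
open import Data.Integer.Properties using (pos-*; *-comm)
open import Data.Integer.Tactic.RingSolver using (solve-∀)
open import Data.Nat as ℕ using (ℕ; suc; _∸_; _≥_; s≤s)
open import Data.Rational as ℚ using (1/_; _+_; _/_; toℚᵘ)
open import Data.Rational.Properties
  using (toℚᵘ-injective; toℚᵘ-fromℚᵘ; toℚᵘ-homo-+; toℚᵘ-homo-1/)
open import Data.Rational.Unnormalised as ℚᵘ using (mkℚᵘ; *≡*; _≃_)
import Data.Rational.Unnormalised.Properties as ℚᵘ
open import Relation.Binary.PropositionalEquality
  using (_≡_; sym; trans; cong; cong₂; module ≡-Reasoning)

-- Split `s + 1` in the numerator of (s + 1) a / (s b): the summand 1 gives a / (s b), the
-- reciprocal of (n - 1)!!/(n - 2)!!, and in the summand `s` the factor `s` cancels, leaving a / b.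
-- Since `_/_` on `ℚ` reduces to lowest terms, the identity is moved by `toℚᵘ` to unreduced
-- fractions, where equality is cross-multiplication (`/-split`) and a reciprocal swaps numerator
-- and denominator (`1/-≃`).

toℚᵘ-/ : ∀ i n .{{_ : ℕ.NonZero n}} → toℚᵘ (i / n) ≃ i ℚᵘ./ n
toℚᵘ-/ i (suc n) = toℚᵘ-fromℚᵘ (mkℚᵘ i n)

1/-≃ : ∀ p m n .{{_ : ℚᵘ.NonZero p}} .{{_ : ℕ.NonZero m}} .{{_ : ℕ.NonZero n}} →
       p ≃ + m ℚᵘ./ n → ℚᵘ.1/ p ≃ + n ℚᵘ./ m
-- Only a positive numerator can occur: the right side of `eq` is positive.
1/-≃ (mkℚᵘ ℤ.+[1+ a ] b) (suc m) (suc n) (*≡* eq) =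
  *≡* (trans (*-comm (+ suc b) (+ suc m)) (trans (sym eq) (*-comm (+ suc a) (+ suc n))))

1/-/ : ∀ m n .{{_ : ℕ.NonZero m}} .{{_ : ℕ.NonZero n}} .{{_ : ℚ.NonZero (+ m / n)}} →
       toℚᵘ (1/ (+ m / n)) ≃ + n ℚᵘ./ m
1/-/ m n = ℚᵘ.≃-trans (toℚᵘ-homo-1/ (+ m / n)) (1/-≃ (toℚᵘ (+ m / n)) m n (toℚᵘ-/ (+ m) n))

/-split : ∀ s a b .{{_ : ℕ.NonZero s}} .{{_ : ℕ.NonZero b}} .{{_ : ℕ.NonZero (s ℕ.* b)}} →
          + (suc s ℕ.* a) ℚᵘ./ (s ℕ.* b) ≃ + a ℚᵘ./ (s ℕ.* b) ℚᵘ.+ + a ℚᵘ./ b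
-- With `s` and `b` visibly successors the fractions compute, leaving an integer identity; `pos-*`
-- turns it into a polynomial one for the ring solver.
/-split s@(suc _) a b@(suc _) = *≡* (begin
  + (suc s ℕ.* a) ℤ.* + (s ℕ.* b ℕ.* b)
    ≡⟨ cong₂ ℤ._*_ (pos-* (suc s) a) (trans (pos-* (s ℕ.* b) b) (cong (ℤ._* + b) (pos-* s b))) ⟩
  (+ 1 ℤ.+ + s) ℤ.* + a ℤ.* (+ s ℤ.* + b ℤ.* + b)
    ≡⟨ cross-multiplied (+ s) (+ a) (+ b) ⟩
  (+ a ℤ.* + b ℤ.+ + a ℤ.* (+ s ℤ.* + b)) ℤ.* (+ s ℤ.* + b)
    ≡⟨ cong (λ d → (+ a ℤ.* + b ℤ.+ + a ℤ.* d) ℤ.* d) (pos-* s b) ⟨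
  (+ a ℤ.* + b ℤ.+ + a ℤ.* + (s ℕ.* b)) ℤ.* + (s ℕ.* b) ∎)
  where
  open ≡-Reasoning
  cross-multiplied : ∀ x y z → (+ 1 ℤ.+ x) ℤ.* y ℤ.* (x ℤ.* z ℤ.* z)
                             ≡ (y ℤ.* z ℤ.+ y ℤ.* (x ℤ.* z)) ℤ.* (x ℤ.* z)
  cross-multiplied = solve-∀

corollary2p1 : (n : ℕ) → n ≥ 3 →
    n !!/ (n ∸ 1) !!
    ≡ (1/ ((n ∸ 1) !!/ (n ∸ 2) !!)) {{ !!/!!-nonZero (n ∸ 1) (n ∸ 2) }}
    + (n ∸ 2) !!/ (n ∸ 3) !!
corollary2p1 (suc (suc (suc k))) (s≤s (s≤s (s≤s _))) = toℚᵘ-injective (begin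
  toℚᵘ ((3 ℕ.+ k) !!/ s !!)                ≈⟨ toℚᵘ-/ (+ ((3 ℕ.+ k) !!)) (s !!) ⟩
  -- By definition `(3 + k) !!` is `suc s * a` and `s !!` is `s * b`, so `/-split` applies without
  -- rewriting.
  + ((3 ℕ.+ k) !!) ℚᵘ./ s !!               ≈⟨ /-split s a b ⟩
  + a ℚᵘ./ s !! ℚᵘ.+ + a ℚᵘ./ b            ≈⟨ ℚᵘ.+-cong (1/-/ (s !!) a) (toℚᵘ-/ (+ a) b) ⟨
  toℚᵘ (1/ (s !!/ suc k !!)) ℚᵘ.+ toℚᵘ (suc k !!/ k !!)
    ≈⟨ toℚᵘ-homo-+ (1/ (s !!/ suc k !!)) (suc k !!/ k !!) ⟨
  toℚᵘ (1/ (s !!/ suc k !!) + suc k !!/ k !!) ∎)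
  where
  open ℚᵘ.≃-Reasoning
  s = 2 ℕ.+ k
  a = suc k !!
  b = k !!
  instance
    _ = s !!≢0
    _ = suc k !!≢0
    _ = k !!≢0
    _ = !!/!!-nonZero s (suc k)
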